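{- Let $\Sigma_1=(G_1,\sigma_1)$ and $\Sigma_2=(G_2,\sigma_2)$ be two finite, simple, connected signed graphs and let $\Sigma_1\times\Sigma_2$ be their tensor product. Then: (i) $\operatorname{bdim}(\Sigma_1\times\Sigma_2)\leq\operatorname{bdim}(\Sigma_1)$ if $\Sigma_2$ is balanced; (ii) $\operatorname{bdim}(\Sigma_1\times\Sigma_2)\leq\operatorname{bdim}(\Sigma_2)$ if $\Sigma_1$ is balanced.
   Context: A signed graph $\Sigma=(G,\sigma)$ is a graph $G=(V,E)$ with a function $\sigma:E\to\{+1,-1\}$. All graphs are finite, simple, connected and undirected unless otherwise mentioned (the tensor product itself may be disconnected). The sign of a cycle is the product of the signs of its edges; $\Sigma$ is balanced if it has no cycle of sign $-1$. Let $\Omega=\{ -1,0,1\}$, with $\Omega^k\subset\mathbb{R}^k$ carrying the standard inner product $\langle\cdot,\cdot\rangle$. A vector valued switching function ($k$-switching function) for $\Sigma$ is a map $\zeta:V\to\Omega^k$ with $\langle\zeta(u),\zeta(v)\rangle\neq 0$ for every edge $uv\in E$; the switched signed graph $\Sigma^\zeta=(G,\sigma^\zeta)$ has $\sigma^\zeta(uv)=\sigma(uv)\operatorname{sgn}(\langle\zeta(u),\zeta(v)\rangle)$. The balancing dimension $\operatorname{bdim}(\Sigma)$ is the least integer $k\ge 1$ for which there is a $k$-switching function $\zeta:V\to\Omega^k$ such that $\Sigma^\zeta$ is all-positive (every edge has sign $+1$). The tensor product $\Sigma_1\times\Sigma_2$ is the signed graph on $G_1\times G_2$ (vertex set $V(G_1)\times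 V(G_2)$, with $(u_i,v_j)$ adjacent to $(u_k,v_l)$ iff $u_i\sim u_k$ and $v_j\sim v_l$) with signature $\sigma((u_i,v_j)(u_k,v_l))=\sigma_1(u_iu_k)\sigma_2(v_jv_l)$. -}

module Defs where

open import Data.Empty using (⊥-elim)
open import Data.Fin.Base using (Fin)
open import Data.Fin.Properties using (all?; *↔×) renaming (_≟_ to _≟ᶠ_)
open import Data.Integer.Base as ℤ using (ℤ; 0ℤ; 1ℤ; -1ℤ; _◃_)
import Data.Integer.Properties as ℤ
open import Data.List.Base as List using (List; []; _∷_; length; allFin; cartesianProduct)
open import Data.List.Membership.Propositional using (_∈_)
open import Data.List.Membership.Propositional.Properties using (∈-allFin; ∈-map⁺; ∈-cartesianProduct⁺)
open import Data.List.Relation.Unary.Any using (here; there)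
open import Data.List.Relation.Unary.Unique.Propositional using (Unique)
open import Data.Nat.Base as ℕ using (ℕ; zero; suc; _≤_; z≤n; s≤s)
import Data.Nat.Properties as ℕ
open import Data.Product.Base using (Σ; ∃; _×_; _,_; proj₁; proj₂)
open import Data.Product.Function.NonDependent.Propositional using (_×-↔_)
open import Data.Sign.Base as Sign using (Sign)
import Data.Sign.Properties as Sign
open import Data.Vec.Base as Vec using (Vec; []; _∷_)
open import Data.Vec.Properties using (lookup∘tabulate)
open import Function.Base using (_∘_)
open import Function.Bundles using (_↔_; Inverse)
open import Function.Properties.Inverse using (↔-trans; ↔-sym)
open import Relation.Binary.Construct.Closure.ReflexiveTransitive using (Star; ε; _◅_)
open import Relation.Binary.PropositionalEquality
  using (_≡_; _≢_; refl; sym; trans; cong; cong₂; subst)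
open import Relation.Nullary using (¬_; Dec; yes; no)
open import Relation.Nullary.Decidable using (map′; ¬?; _×-dec_)
open import Relation.Unary using (Decidable)

------------------------------------------------------------------------
-- Graphs and signed graphs

record Graph : Set₁ where
  infix 4 _∼_
  field
    Vertex   : Set
    order    : ℕ
    finite   : Vertex ↔ Fin order
    _∼_      : Vertex → Vertex → Set
    _∼?_     : ∀ u v → Dec (u ∼ v)
    ∼-sym    : ∀ {u v} → u ∼ v → v ∼ u
    ∼-irrefl : ∀ {u} → ¬ (u ∼ u)

Walk : (G : Graph) → Graph.Vertex G → Graph.Vertex G → Set
Walk G = Star (Graph._∼_ G)

Connected : Graph → Set
Connected G = ∀ u v → Walk G u v

record SignedGraph : Set₁ where
  field
    graph : Graph
  open Graph graph public
  field
    σ     : ∀ {u v} → u ∼ v → Sign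
    -- This also makes σ independent of the proof of adjacency, so that σ is a
    -- function on undirected edges (see σ-irrelevant).
    σ-sym : ∀ {u v} (e : u ∼ v) (e′ : v ∼ u) → σ e ≡ σ e′

  σ-irrelevant : ∀ {u v} (e e′ : u ∼ v) → σ e ≡ σ e′
  σ-irrelevant e e′ = trans (σ-sym e (∼-sym e)) (sym (σ-sym e′ (∼-sym e)))

------------------------------------------------------------------------
-- Cycles and balance

module _ (G : Graph) where
  open Graph G

  -- The final vertex of the walk is not listed, so that a closed walk lists its
  -- base point once.
  vertices : ∀ {u v} → Walk G u v → List Vertex
  vertices ε                 = []
  vertices (_◅_ {i = u} _ w) = u ∷ vertices w

  IsCycle : ∀ {u} → Walk G u u → Set
  IsCycle w = 3 ≤ length (vertices w) × Unique (vertices w)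

module _ (S : SignedGraph) where
  open SignedGraph S

  walkSign : ∀ {u v} → Walk graph u v → Sign
  walkSign ε       = Sign.+
  walkSign (e ◅ w) = σ e Sign.* walkSign w

  Balanced : Set
  Balanced = ∀ {u} (w : Walk graph u u) → IsCycle graph w → walkSign w ≢ Sign.-

  AllPositive : Set
  AllPositive = ∀ {u v} (e : u ∼ v) → σ e ≡ Sign.+

------------------------------------------------------------------------
-- Tensor product

infixr 7 _×ᴳ_ _×ˢ_

_×ᴳ_ : Graph → Graph → Graph
G ×ᴳ H = record
  { Vertex   = G.Vertex × H.Vertex
  ; order    = G.order ℕ.* H.order
  ; finite   = ↔-trans (G.finite ×-↔ H.finite) (↔-sym *↔×)
  ; _∼_      = λ (u , v) (u′ , v′) → (u G.∼ u′) × (v H.∼ v′)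
  ; _∼?_     = λ (u , v) (u′ , v′) → (u G.∼? u′) ×-dec (v H.∼? v′)
  ; ∼-sym    = λ (e , f) → G.∼-sym e , H.∼-sym f
  ; ∼-irrefl = λ (e , _) → G.∼-irrefl e
  }
  where
  module G = Graph G
  module H = Graph H

_×ˢ_ : SignedGraph → SignedGraph → SignedGraph
S ×ˢ T = record
  { graph = S.graph ×ᴳ T.graph
  ; σ     = λ (e , f) → S.σ e Sign.* T.σ f
  ; σ-sym = λ (e , f) (e′ , f′) → cong₂ Sign._*_ (S.σ-sym e e′) (T.σ-sym f f′)
  }
  where
  module S = SignedGraph S
  module T = SignedGraph T

------------------------------------------------------------------------
-- Vector valued switching

data Ω : Set where
  -1Ω 0Ω 1Ω : Ω

toℤ : Ω → ℤ
toℤ -1Ω = -1ℤ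
toℤ 0Ω  = 0ℤ
toℤ 1Ω  = 1ℤ

-- The standard inner product of ℝᵏ takes integer values on Ωᵏ.
⟨_,_⟩ : ∀ {k} → Vec Ω k → Vec Ω k → ℤ
⟨ []     , []     ⟩ = 0ℤ
⟨ x ∷ xs , y ∷ ys ⟩ = toℤ x ℤ.* toℤ y ℤ.+ ⟨ xs , ys ⟩

⟨,⟩-comm : ∀ {k} (xs ys : Vec Ω k) → ⟨ xs , ys ⟩ ≡ ⟨ ys , xs ⟩
⟨,⟩-comm []       []       = refl
⟨,⟩-comm (x ∷ xs) (y ∷ ys) = cong₂ ℤ._+_ (ℤ.*-comm (toℤ x) (toℤ y)) (⟨,⟩-comm xs ys)

record SwitchingFunction (k : ℕ) (G : Graph) : Set where
  open Graph G
  field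
    ζ       : Vertex → Vec Ω k
    nonzero : ∀ {u v} → u ∼ v → ⟨ ζ u , ζ v ⟩ ≢ 0ℤ

-- ℤ.sign sends 0 to +, but it is only applied to nonzero inner products.
switch : ∀ {k} (S : SignedGraph) → SwitchingFunction k (SignedGraph.graph S) → SignedGraph
switch S Z = record
  { graph = graph
  ; σ     = λ {u} {v} e → σ e Sign.* ℤ.sign ⟨ ζ u , ζ v ⟩
  ; σ-sym = λ {u} {v} e e′ →
      cong₂ Sign._*_ (σ-sym e e′) (cong ℤ.sign (⟨,⟩-comm (ζ u) (ζ v)))
  }
  where
  open SignedGraph S
  open SwitchingFunction Z

SwitchesToPositive : SignedGraph → ℕ → Set
SwitchesToPositive S k =
  Σ (SwitchingFunction k (SignedGraph.graph S)) λ Z → AllPositive (switch S Z)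

record IsBalancingDimension (S : SignedGraph) (k : ℕ) : Set where
  field
    positive : 1 ≤ k
    attained : SwitchesToPositive S k
    minimal  : ∀ {j} → 1 ≤ j → SwitchesToPositive S j → k ≤ j

------------------------------------------------------------------------
-- Every signed graph has a balancing dimension

-- SwitchesToPositive S k is decidable by exhaustive search, and it holds for
-- some k ≥ 1, so a least such k exists.

private

  Searchable : Set → Set₁
  Searchable A = ∀ {P : A → Set} → Decidable P → Dec (∃ P)

  searchΩ : Searchable Ω
  searchΩ P? with P? -1Ω | P? 0Ω | P? 1Ω
  ... | yes p | _     | _     = yes (_ , p)
  ... | no _  | yes p | _     = yes (_ , p)
  ... | no _  | no _  | yes p = yes (_ , p)
  ... | no ¬p | no ¬q | no ¬r =
    no λ { (-1Ω , p) → ¬p p ; (0Ω , q) → ¬q q ; (1Ω , r) → ¬r r }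

  searchVec : ∀ {A} → Searchable A → ∀ n → Searchable (Vec A n)
  searchVec s zero    P? = map′ (λ p → [] , p) (λ { ([] , p) → p }) (P? [])
  searchVec s (suc n) P? =
    map′ (λ (x , xs , p) → x ∷ xs , p) (λ { (x ∷ xs , p) → x , xs , p })
         (s λ x → searchVec s n λ xs → P? (x ∷ xs))

  least : ∀ {P : ℕ → Set} → Decidable P → ∀ n → P n →
          ∃ λ m → P m × (∀ {j} → P j → m ≤ j)
  least P? zero    p = zero , p , λ _ → z≤n
  least {P} P? (suc n) p with P? zero
  ... | yes q = zero , q , λ _ → z≤n
  ... | no ¬q with least (P? ∘ suc) n p
  ...   | m , r , min = suc m , r , λ {j} → bound j
    where
    bound : ∀ j → P j → suc m ≤ j
    bound zero    q = ⊥-elim (¬q q)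
    bound (suc j) q = s≤s (min q)

module _ (S : SignedGraph) where
  open SignedGraph S

  private
    index : Vertex → Fin order
    index = Inverse.to finite

    vertex : Fin order → Vertex
    vertex = Inverse.from finite

    vertex-index : ∀ u → vertex (index u) ≡ u
    vertex-index = Inverse.strictlyInverseʳ finite

    index-injective : ∀ {u v} → index u ≡ index v → u ≡ v
    index-injective {u} {v} p =
      trans (sym (vertex-index u)) (trans (cong vertex p) (vertex-index v))

    _≟ⱽ_ : (u v : Vertex) → Dec (u ≡ v)
    u ≟ⱽ v = map′ index-injective (cong index) (index u ≟ᶠ index v)

    ∀Vertex? : ∀ {P : Vertex → Set} → Decidable P → Dec (∀ u → P u)
    ∀Vertex? {P} P? =
      map′ (λ f u → subst P (vertex-index u) (f (index u))) (λ f → f ∘ vertex)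
           (all? (P? ∘ vertex))

    GoodPair : ∀ {k} → (Vertex → Vec Ω k) → Vertex → Vertex → Set
    GoodPair ζ u v = (e : u ∼ v) →
      ⟨ ζ u , ζ v ⟩ ≢ 0ℤ × σ e Sign.* ℤ.sign ⟨ ζ u , ζ v ⟩ ≡ Sign.+

    Good : ∀ {k} → (Vertex → Vec Ω k) → Set
    Good ζ = ∀ u v → GoodPair ζ u v

    goodPair? : ∀ {k} (ζ : Vertex → Vec Ω k) u v → Dec (GoodPair ζ u v)
    goodPair? ζ u v with u ∼? v
    ... | no ¬e = yes (⊥-elim ∘ ¬e)
    ... | yes e = map′
      (λ (p , q) e′ →
        p , trans (cong (Sign._* ℤ.sign ⟨ ζ u , ζ v ⟩) (σ-irrelevant e′ e)) q)
      (λ f → f e)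
      (¬? (⟨ ζ u , ζ v ⟩ ℤ.≟ 0ℤ)
        ×-dec (σ e Sign.* ℤ.sign ⟨ ζ u , ζ v ⟩ Sign.≟ Sign.+))

    good? : ∀ {k} (ζ : Vertex → Vec Ω k) → Dec (Good ζ)
    good? ζ = ∀Vertex? λ u → ∀Vertex? λ v → goodPair? ζ u v

    good-resp : ∀ {k} {ζ ξ : Vertex → Vec Ω k} → (∀ u → ζ u ≡ ξ u) → Good ζ → Good ξ
    good-resp {ζ = ζ} {ξ} eq g u v e with ζ u | eq u | ζ v | eq v | g u v e
    ... | _ | refl | _ | refl | h = h

    fromGood : ∀ {k} {ζ : Vertex → Vec Ω k} → Good ζ → SwitchesToPositive S k
    fromGood {ζ = ζ} g =
      record { ζ = ζ ; nonzero = λ e → proj₁ (g _ _ e) } , λ e → proj₂ (g _ _ e)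

    toGood : ∀ {k} ((Z , _) : SwitchesToPositive S k) → Good (SwitchingFunction.ζ Z)
    toGood (Z , p) _ _ e = SwitchingFunction.nonzero Z e , p e

  switchesToPositive? : Decidable (SwitchesToPositive S)
  switchesToPositive? k = map′
    (λ (xs , g) → fromGood {ζ = λ u → Vec.lookup xs (index u)} g)
    (λ z → let ζ = SwitchingFunction.ζ (proj₁ z) in
      Vec.tabulate (ζ ∘ vertex) ,
      good-resp
        (λ u → sym (trans (lookup∘tabulate (ζ ∘ vertex) (index u))
                          (cong ζ (vertex-index u))))
        (toGood z))
    (searchVec (searchVec searchΩ k) order λ xs → good? (λ u → Vec.lookup xs (index u)))

  private
    -- One coordinate for each ordered pair (i , j) of vertices: if i ∼ j it is
    -- 1 at i, the sign of the edge at j, and 0 at every other vertex; if not,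
    -- it is 0 at every vertex.

    Pair : Set
    Pair = Vertex × Vertex

    signΩ : Sign → Ω
    signΩ Sign.- = -1Ω
    signΩ Sign.+ = 1Ω

    coord : Pair → Vertex → Ω
    coord (i , j) u with i ∼? j
    ... | no _ = 0Ω
    ... | yes e with u ≟ⱽ i | u ≟ⱽ j
    ...   | yes _ | _     = 1Ω
    ...   | no _  | yes _ = signΩ (σ e)
    ...   | no _  | no _  = 0Ω

    0·ˡ : ∀ s x → ∃ λ n → toℤ 0Ω ℤ.* toℤ x ≡ s ◃ n
    0·ˡ s x = 0 , ℤ.*-zeroˡ (toℤ x)

    0·ʳ : ∀ s x → ∃ λ n → toℤ x ℤ.* toℤ 0Ω ≡ s ◃ n
    0·ʳ s x = 0 , ℤ.*-zeroʳ (toℤ x)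

    1·sign : ∀ s → toℤ 1Ω ℤ.* toℤ (signΩ s) ≡ s ◃ 1
    1·sign Sign.- = refl
    1·sign Sign.+ = refl

    sign·1 : ∀ s → toℤ (signΩ s) ℤ.* toℤ 1Ω ≡ s ◃ 1
    sign·1 Sign.- = refl
    sign·1 Sign.+ = refl

    coord-term : ∀ p {u v} (e : u ∼ v) → ∃ λ n → toℤ (coord p u) ℤ.* toℤ (coord p v) ≡ σ e ◃ n
    coord-term (i , j) {u} {v} e with i ∼? j
    ... | no _ = 0 , refl
    ... | yes f with u ≟ⱽ i | u ≟ⱽ j | v ≟ⱽ i | v ≟ⱽ j
    ...   | yes refl | _        | yes refl | _        = ⊥-elim (∼-irrefl e)
    ...   | yes refl | _        | no _     | yes refl =
      1 , trans (1·sign (σ f)) (cong (_◃ 1) (σ-irrelevant f e))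
    ...   | yes _    | _        | no _     | no _     = 0·ʳ (σ e) 1Ω
    ...   | no _     | yes refl | yes refl | _        =
      1 , trans (sign·1 (σ f)) (cong (_◃ 1) (σ-sym f e))
    ...   | no _     | yes refl | no _     | yes refl = ⊥-elim (∼-irrefl e)
    ...   | no _     | yes _    | no _     | no _     = 0·ʳ (σ e) (signΩ (σ f))
    ...   | no _     | no _     | yes _    | _        = 0 , refl
    ...   | no _     | no _     | no _     | yes _    = 0·ˡ (σ e) (signΩ (σ f))
    ...   | no _     | no _     | no _     | no _     = 0 , refl

    coord-edge : ∀ {u v} (e : u ∼ v) →
                 toℤ (coord (u , v) u) ℤ.* toℤ (coord (u , v) v) ≡ σ e ◃ 1
    coord-edge {u} {v} e with u ∼? v
    ... | no ¬e = ⊥-elim (¬e e)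
    ... | yes f with u ≟ⱽ u | u ≟ⱽ v | v ≟ⱽ u | v ≟ⱽ v
    ...   | no ¬p | _        | _        | _     = ⊥-elim (¬p refl)
    ...   | yes _ | yes refl | _        | _     = ⊥-elim (∼-irrefl e)
    ...   | yes _ | no _     | yes refl | _     = ⊥-elim (∼-irrefl e)
    ...   | yes _ | no _     | no _     | no ¬p = ⊥-elim (¬p refl)
    ...   | yes _ | no _     | no _     | yes _ =
      trans (1·sign (σ f)) (cong (_◃ 1) (σ-irrelevant f e))

    coords : (ps : List Pair) → Vertex → Vec Ω (length ps)
    coords []       u = []
    coords (p ∷ ps) u = coord p u ∷ coords ps u

    coords-◃ : ∀ ps {u v} (e : u ∼ v) → ∃ λ n → ⟨ coords ps u , coords ps v ⟩ ≡ σ e ◃ n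
    coords-◃ []       e = 0 , refl
    coords-◃ (p ∷ ps) e with coord-term p e | coords-◃ ps e
    ... | m , eq | n , eq′ = m ℕ.+ n , trans (cong₂ ℤ._+_ eq eq′) (sym (ℤ.◃-distrib-+ (σ e) m n))

    coords-◃suc : ∀ ps {u v} (e : u ∼ v) → (u , v) ∈ ps →
                  ∃ λ n → ⟨ coords ps u , coords ps v ⟩ ≡ σ e ◃ suc n
    coords-◃suc (p ∷ ps) e (here refl) with coords-◃ ps e
    ... | n , eq = n , trans (cong₂ ℤ._+_ (coord-edge e) eq) (sym (ℤ.◃-distrib-+ (σ e) 1 n))
    coords-◃suc (p ∷ ps) e (there p∈) with coord-term p e | coords-◃suc ps e p∈
    ... | m , eq | n , eq′ = m ℕ.+ n ,
      trans (cong₂ ℤ._+_ eq eq′)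
        (trans (sym (ℤ.◃-distrib-+ (σ e) m (suc n))) (cong (σ e ◃_) (ℕ.+-suc m n)))

    allVertices : List Vertex
    allVertices = List.map vertex (allFin order)

    ∈-allVertices : ∀ u → u ∈ allVertices
    ∈-allVertices u = subst (_∈ allVertices) (vertex-index u) (∈-map⁺ vertex (∈-allFin (index u)))

    pairs : List Pair
    pairs = cartesianProduct allVertices allVertices

    -- The extra zero coordinate makes the dimension positive.
    paddedCoords : Vertex → Vec Ω (suc (length pairs))
    paddedCoords u = 0Ω ∷ coords pairs u

    good-coords : Good paddedCoords
    good-coords u v e
      with coords-◃suc pairs e (∈-cartesianProduct⁺ (∈-allVertices u) (∈-allVertices v))
    ... | n , eq rewrite trans (ℤ.+-identityˡ ⟨ coords pairs u , coords pairs v ⟩) eq with σ e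
    ...   | Sign.- = (λ ()) , refl
    ...   | Sign.+ = (λ ()) , refl

  balancingDimension : ∃ (IsBalancingDimension S)
  balancingDimension with least (switchesToPositive? ∘ suc) (length pairs) (fromGood {ζ = paddedCoords} good-coords)
  ... | m , p , min = suc m , record
    { positive = s≤s z≤n
    ; attained = p
    ; minimal  = λ { (s≤s _) q → s≤s (min q) }
    }

  bdim : ℕ
  bdim = proj₁ balancingDimension

  bdim-isBalancingDimension : IsBalancingDimension S bdim
  bdim-isBalancingDimension = proj₂ balancingDimension

-- A balanced signed graph has a potential s : V → {±1} with σ(uv) = s(u)s(v)
-- (Harary), so a switching function ζ of one factor gives the switching
-- function (u , v) ↦ s(v)ζ(u) of the tensor product, in the same dimension:
-- the sign s(v)s(v′) that it adds to the inner product cancels the sign of the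
-- edge in the balanced factor. Harary's potential needs every closed walk to be
-- positive; this follows from loop erasure, which removes only cycles and
-- immediate reversals u, v, u, all of them positive.
module Submission where

open import Defs
open import Algebra.Properties.CommutativeSemigroup using (interchange)
open import Data.Empty using (⊥-elim)
open import Data.Fin.Base using (Fin; zero; suc)
open import Data.Fin.Properties using (inj⇒≟)
open import Data.Integer.Base as ℤ using (0ℤ; _◃_)
import Data.Integer.Properties as ℤ
open import Data.List.Base using (List; []; _∷_; _++_)
open import Data.List.Membership.Propositional using (_∈_)
import Data.List.Membership.DecPropositional as DecMembership
open import Data.List.Relation.Unary.All using ([]; _∷_)
import Data.List.Relation.Unary.All.Properties as All
open import Data.List.Relation.Unary.Any using (here; there)
open import Data.List.Relation.Unary.AllPairs using ([]; _∷_)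
open import Data.List.Relation.Unary.Unique.Propositional using (Unique)
open import Data.List.Relation.Unary.Unique.Propositional.Properties using (Unique[x∷xs]⇒x∉xs)
open import Data.Nat.Base using (_≤_; z≤n; s≤s)
open import Data.Product.Base using (∃; ∃₂; _×_; _,_; proj₁; proj₂)
open import Data.Sign.Base as Sign using (Sign)
import Data.Sign.Properties as Sign
open import Data.Sum.Base using ([_,_]′)
open import Data.Vec.Base using (Vec; []; _∷_; map)
open import Function.Base using (_∘_)
open import Function.Bundles using (Inverse)
open import Function.Properties.Inverse using (↔⇒↣)
open import Relation.Binary.Construct.Closure.ReflexiveTransitive using (ε; _◅_; _◅◅_)
open import Relation.Binary.Definitions using (DecidableEquality)
open import Relation.Binary.PropositionalEquality
open import Relation.Nullary using (yes; no)

open ≡-Reasoning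

-- Signs and duplicate-free lists.

≢-⇒≡+ : ∀ {s} → s ≢ Sign.- → s ≡ Sign.+
≢-⇒≡+ {Sign.-} s≢- = ⊥-elim (s≢- refl)
≢-⇒≡+ {Sign.+} _   = refl

*≡+⇒≡ : ∀ s t → s Sign.* t ≡ Sign.+ → s ≡ t
*≡+⇒≡ s t eq = Sign.*-cancelʳ-≡ t s t (trans eq (sym (Sign.s*s≡+ t)))

-- Used where a path is cut at `y`: the first component lets the initial segment be closed up into a
-- loop at `y`, the second keeps the rest a path.
Unique-++∷⁻ : ∀ {A : Set} xs {y : A} {ys} → Unique (xs ++ y ∷ ys) →
              Unique (y ∷ xs) × Unique (y ∷ ys)
Unique-++∷⁻ []       ys! = [] ∷ [] , ys!
Unique-++∷⁻ (x ∷ xs) (x∉ ∷ rest!) with Unique-++∷⁻ xs rest! | All.++⁻ xs x∉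
... | y∉xs ∷ xs! , ys! | x∉xs , x≢y ∷ _ = (≢-sym x≢y ∷ y∉xs) ∷ x∉xs ∷ xs! , ys!

-- Walks, paths and loop erasure.

module _ (G : Graph) where
  open Graph G

  _≟ⱽ_ : DecidableEquality Vertex
  _≟ⱽ_ = inj⇒≟ (↔⇒↣ finite)

  -- Complementary to `vertices`: the start is omitted instead of the end, so `u ∷ targets w` lists
  -- every visited vertex, both ends included.
  targets : ∀ {u v} → Walk G u v → List Vertex
  targets ε                 = []
  targets (_◅_ {j = v} _ w) = v ∷ targets w

  IsPath : ∀ {u v} → Walk G u v → Set
  IsPath {u} w = Unique (u ∷ targets w)

  target∈targets : ∀ {u v} (w : Walk G u v) → v ∈ u ∷ targets w
  target∈targets ε       = here refl
  target∈targets (_ ◅ w) = there (target∈targets w)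

module _ (S : SignedGraph) where
  open SignedGraph S

  walkSign-◅◅ : ∀ {u v x} (w : Walk graph u v) (w′ : Walk graph v x) →
                walkSign S (w ◅◅ w′) ≡ walkSign S w Sign.* walkSign S w′
  walkSign-◅◅ ε       w′ = refl
  walkSign-◅◅ (e ◅ w) w′ = trans (cong (σ e Sign.*_) (walkSign-◅◅ w w′))
                                 (sym (Sign.*-assoc (σ e) _ _))

  splitAt : ∀ {u v x} (w : Walk graph u v) → x ∈ u ∷ targets graph w →
            ∃₂ λ (p : Walk graph u x) (q : Walk graph x v) →
              u ∷ targets graph w ≡ vertices graph p ++ x ∷ targets graph q ×
              walkSign S w ≡ walkSign S p Sign.* walkSign S q
  splitAt w       (here refl) = ε , w , refl , refl
  splitAt (e ◅ w) (there x∈) with splitAt w x∈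
  ... | p , q , eq , eq′ = e ◅ p , q , cong (_ ∷_) eq ,
    trans (cong (σ e Sign.*_) eq′) (sym (Sign.*-assoc (σ e) _ _))

  -- A nonempty closed walk lists its base point at both ends, so only `ε` is a path.
  closedPath-positive : ∀ {u} (w : Walk graph u u) → IsPath graph w → walkSign S w ≡ Sign.+
  closedPath-positive ε       _  = refl
  closedPath-positive (e ◅ w) w! = ⊥-elim (Unique[x∷xs]⇒x∉xs w! (target∈targets graph w))

  module _ (balanced : Balanced S) where

    -- By length: 1 would be a graph loop, 2 runs along one edge and back and gives a square, and
    -- from 3 on the closed walk is a cycle, to which balance applies.
    closeUp-positive : ∀ {u v} (e : u ∼ v) (p : Walk graph v u) →
                       Unique (u ∷ vertices graph p) → walkSign S (e ◅ p) ≡ Sign.+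
    closeUp-positive e ε _ = ⊥-elim (∼-irrefl e)
    closeUp-positive e (f ◅ ε) _ = begin
      σ e Sign.* (σ f Sign.* Sign.+)  ≡⟨ cong (σ e Sign.*_) (Sign.*-identityʳ (σ f)) ⟩
      σ e Sign.* σ f                  ≡⟨ cong (σ e Sign.*_) (σ-sym f e) ⟩
      σ e Sign.* σ e                  ≡⟨ Sign.s*s≡+ (σ e) ⟩
      Sign.+                          ∎
    closeUp-positive e p@(_ ◅ _ ◅ _) p! =
      ≢-⇒≡+ (balanced (e ◅ p) (s≤s (s≤s (s≤s z≤n)) , p!))

    -- Loops are erased from the tail first. If `u` lies on the resulting path, then `e` and the
    -- segment up to `u` close up to a positive loop, which is dropped.
    eraseLoops : ∀ {u v} (w : Walk graph u v) →
                 ∃ λ (p : Walk graph u v) → IsPath graph p × walkSign S w ≡ walkSign S p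
    eraseLoops ε = ε , [] ∷ [] , refl
    eraseLoops {u} (_◅_ {j = x} e w) with eraseLoops w
    ... | p , p! , eq with DecMembership._∈?_ (_≟ⱽ_ graph) u (x ∷ targets graph p)
    ...   | no u∉p  = e ◅ p , All.¬Any⇒All¬ _ u∉p ∷ p! , cong (σ e Sign.*_) eq
    ...   | yes u∈p with splitAt p u∈p
    ...     | q , r , support-eq , sign-eq
            with Unique-++∷⁻ (vertices graph q) (subst Unique support-eq p!)
    ...       | q! , r! = r , r! , (begin
      σ e Sign.* walkSign S w                       ≡⟨ cong (σ e Sign.*_) (trans eq sign-eq) ⟩
      σ e Sign.* (walkSign S q Sign.* walkSign S r) ≡⟨ Sign.*-assoc (σ e) _ _ ⟨
      walkSign S (e ◅ q) Sign.* walkSign S r        ≡⟨ cong (Sign._* walkSign S r) (closeUp-positive e q q!) ⟩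
      walkSign S r                                  ∎)

    closedWalk-positive : ∀ {u} (w : Walk graph u u) → walkSign S w ≡ Sign.+
    closedWalk-positive w with eraseLoops w
    ... | p , p! , eq = trans eq (closedPath-positive p p!)

  -- Harary's potential.

  IsPotential : (Vertex → Sign) → Set
  IsPotential s = ∀ {u v} (e : u ∼ v) → σ e ≡ s u Sign.* s v

  module _ (connected : Connected graph) (balanced : Balanced S) where

    private
      first : ∀ {n} → Fin n → Fin n
      first zero    = zero
      first (suc _) = zero

      first-constant : ∀ {n} (i j : Fin n) → first i ≡ first j
      first-constant zero    zero    = refl
      first-constant zero    (suc _) = refl
      first-constant (suc _) zero    = refl
      first-constant (suc _) (suc _) = refl

      -- The root is constant, but since the graph may have no vertex it can
      -- only be chosen once some vertex is given.
      root : Vertex → Vertex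
      root = Inverse.from finite ∘ first ∘ Inverse.to finite

      root-constant : ∀ u v → root u ≡ root v
      root-constant u v = cong (Inverse.from finite)
        (first-constant (Inverse.to finite u) (Inverse.to finite v))

    potential : Vertex → Sign
    potential u = walkSign S (connected (root u) u)

    -- Both walks out of `r` are compared with the same walk `back` from `v`, preceded by `e` in the
    -- case of `u`; each comparison closes up a walk, which is positive.
    edge-from-root : ∀ r {u v} (e : u ∼ v) →
      σ e ≡ walkSign S (connected r u) Sign.* walkSign S (connected r v)
    edge-from-root r {u} {v} e = sym (begin
      out u Sign.* out v                  ≡⟨ cong₂ Sign._*_ out-u out-v ⟩
      (σ e Sign.* back) Sign.* back       ≡⟨ Sign.*-assoc (σ e) back back ⟩
      σ e Sign.* (back Sign.* back)       ≡⟨ cong (σ e Sign.*_) (Sign.s*s≡+ back) ⟩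
      σ e Sign.* Sign.+                   ≡⟨ Sign.*-identityʳ (σ e) ⟩
      σ e                                 ∎)
      where
      out : Vertex → Sign
      out x = walkSign S (connected r x)

      back : Sign
      back = walkSign S (connected v r)

      closing : ∀ {x} (w : Walk graph x r) → out x ≡ walkSign S w
      closing {x} w = *≡+⇒≡ (out x) (walkSign S w)
        (trans (sym (walkSign-◅◅ (connected r x) w))
               (closedWalk-positive balanced (connected r x ◅◅ w)))

      out-u : out u ≡ σ e Sign.* back
      out-u = closing (e ◅ connected v r)

      out-v : out v ≡ back
      out-v = closing (connected v r)

    potential-isPotential : IsPotential potential
    -- `potential v` is measured from `root v`, so the base point has to be moved there from
    -- `root u`.
    potential-isPotential {u} {v} e = trans (edge-from-root (root u) e)
      (cong (λ r → potential u Sign.* walkSign S (connected r v)) (root-constant u v))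

-- Sign changes of vectors and pullback of switching functions.

infixr 7 _·_

_·_ : Sign → Ω → Ω
Sign.+ · x   = x
Sign.- · -1Ω = 1Ω
Sign.- · 0Ω  = 0Ω
Sign.- · 1Ω  = -1Ω

toℤ-· : ∀ s x → toℤ (s · x) ≡ (s ◃ 1) ℤ.* toℤ x
toℤ-· Sign.+ -1Ω = refl
toℤ-· Sign.+ 0Ω  = refl
toℤ-· Sign.+ 1Ω  = refl
toℤ-· Sign.- -1Ω = refl
toℤ-· Sign.- 0Ω  = refl
toℤ-· Sign.- 1Ω  = refl

⟨·,·⟩ : ∀ {k} s t (xs ys : Vec Ω k) →
        ⟨ map (s ·_) xs , map (t ·_) ys ⟩ ≡ (s Sign.* t ◃ 1) ℤ.* ⟨ xs , ys ⟩
⟨·,·⟩ s t []       []       = sym (ℤ.*-zeroʳ (s Sign.* t ◃ 1))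
⟨·,·⟩ s t (x ∷ xs) (y ∷ ys) = begin
  toℤ (s · x) ℤ.* toℤ (t · y) ℤ.+ ⟨ map (s ·_) xs , map (t ·_) ys ⟩
    ≡⟨ cong₂ ℤ._+_ term (⟨·,·⟩ s t xs ys) ⟩
  c ℤ.* (toℤ x ℤ.* toℤ y) ℤ.+ c ℤ.* ⟨ xs , ys ⟩
    ≡⟨ ℤ.*-distribˡ-+ c (toℤ x ℤ.* toℤ y) ⟨ xs , ys ⟩ ⟨
  c ℤ.* ⟨ x ∷ xs , y ∷ ys ⟩ ∎
  where
  c = s Sign.* t ◃ 1

  term : toℤ (s · x) ℤ.* toℤ (t · y) ≡ c ℤ.* (toℤ x ℤ.* toℤ y)
  term = begin
    toℤ (s · x) ℤ.* toℤ (t · y)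
      ≡⟨ cong₂ ℤ._*_ (toℤ-· s x) (toℤ-· t y) ⟩
    ((s ◃ 1) ℤ.* toℤ x) ℤ.* ((t ◃ 1) ℤ.* toℤ y)
      ≡⟨ interchange ℤ.*-commutativeSemigroup (s ◃ 1) (toℤ x) (t ◃ 1) (toℤ y) ⟩
    ((s ◃ 1) ℤ.* (t ◃ 1)) ℤ.* (toℤ x ℤ.* toℤ y)
      ≡⟨ cong (ℤ._* (toℤ x ℤ.* toℤ y)) (ℤ.◃-distrib-* s t 1 1) ⟨
    c ℤ.* (toℤ x ℤ.* toℤ y) ∎

◃1*-≢0 : ∀ s {i} → i ≢ 0ℤ → (s ◃ 1) ℤ.* i ≢ 0ℤ
◃1*-≢0 Sign.+ i≢0 eq = [ (λ ()) , i≢0 ]′ (ℤ.i*j≡0⇒i≡0∨j≡0 (Sign.+ ◃ 1) eq)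
◃1*-≢0 Sign.- i≢0 eq = [ (λ ()) , i≢0 ]′ (ℤ.i*j≡0⇒i≡0∨j≡0 (Sign.- ◃ 1) eq)

-- At `0ℤ` this fails for `Sign.-`, because `ℤ.sign` sends zero to `Sign.+`.
sign-◃1* : ∀ s {i} → i ≢ 0ℤ → ℤ.sign ((s ◃ 1) ℤ.* i) ≡ s Sign.* ℤ.sign i
sign-◃1* s {i} i≢0 = trans
  (ℤ.sign-* (s ◃ 1) i {{ℤ.≢-nonZero (◃1*-≢0 s i≢0)}})
  (cong (Sign._* ℤ.sign i) (ℤ.sign-◃ s 1))

-- Common form of both halves: `f` will be the projection to one factor, `s` the potential of the
-- other. The factor `s u Sign.* s v` enters once through the signature and once through the inner
-- product, and so cancels.
switchesToPositive-pullback : (T S : SignedGraph) →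
  (let module T = SignedGraph T; module S = SignedGraph S)
  (f : T.Vertex → S.Vertex) (f-∼ : ∀ {u v} → u T.∼ v → f u S.∼ f v)
  (s : T.Vertex → Sign) →
  (∀ {u v} (e : u T.∼ v) → T.σ e ≡ S.σ (f-∼ e) Sign.* (s u Sign.* s v)) →
  ∀ {k} → SwitchesToPositive S k → SwitchesToPositive T k
switchesToPositive-pullback T S f f-∼ s σ-eq {k} (Z , positive) =
  record { ζ = ξ ; nonzero = ξ-nonzero } , ξ-positive
  where
  module T = SignedGraph T
  module S = SignedGraph S
  open SwitchingFunction Z

  ξ : T.Vertex → Vec Ω k
  ξ u = map (s u ·_) (ζ (f u))

  ⟨ξ,ξ⟩ : ∀ u v → ⟨ ξ u , ξ v ⟩ ≡ (s u Sign.* s v ◃ 1) ℤ.* ⟨ ζ (f u) , ζ (f v) ⟩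
  ⟨ξ,ξ⟩ u v = ⟨·,·⟩ (s u) (s v) (ζ (f u)) (ζ (f v))

  ξ-nonzero : ∀ {u v} → u T.∼ v → ⟨ ξ u , ξ v ⟩ ≢ 0ℤ
  ξ-nonzero {u} {v} e eq =
    ◃1*-≢0 (s u Sign.* s v) (nonzero (f-∼ e)) (trans (sym (⟨ξ,ξ⟩ u v)) eq)

  ξ-positive : ∀ {u v} (e : u T.∼ v) → T.σ e Sign.* ℤ.sign ⟨ ξ u , ξ v ⟩ ≡ Sign.+
  ξ-positive {u} {v} e = begin
    T.σ e Sign.* ℤ.sign ⟨ ξ u , ξ v ⟩
      ≡⟨ cong₂ Sign._*_ (σ-eq e)
           (trans (cong ℤ.sign (⟨ξ,ξ⟩ u v)) (sign-◃1* a (nonzero (f-∼ e)))) ⟩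
    (S.σ (f-∼ e) Sign.* a) Sign.* (a Sign.* b)
      ≡⟨ cong (Sign._* (a Sign.* b)) (Sign.*-comm (S.σ (f-∼ e)) a) ⟩
    (a Sign.* S.σ (f-∼ e)) Sign.* (a Sign.* b)
      ≡⟨ interchange Sign.*-commutativeSemigroup a (S.σ (f-∼ e)) a b ⟩
    (a Sign.* a) Sign.* (S.σ (f-∼ e) Sign.* b)
      ≡⟨ cong₂ Sign._*_ (Sign.s*s≡+ a) (positive (f-∼ e)) ⟩
    Sign.+ ∎
    where
    a = s u Sign.* s v
    b = ℤ.sign ⟨ ζ (f u) , ζ (f v) ⟩

-- A switching function attaining `bdim S` is transferred in the same dimension and competes in the
-- minimum for `T`.
bdim-mono : (T S : SignedGraph) →
  (∀ {k} → SwitchesToPositive S k → SwitchesToPositive T k) → bdim T ≤ bdim S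
bdim-mono T S transfer = minimal (bdim-isBalancingDimension T)
  (positive (bdim-isBalancingDimension S))
  (transfer (attained (bdim-isBalancingDimension S)))
  where open IsBalancingDimension

theorem2p28 : (Σ₁ Σ₂ : SignedGraph) →
    Connected (SignedGraph.graph Σ₁) → Connected (SignedGraph.graph Σ₂) →
    (Balanced Σ₂ → bdim (Σ₁ ×ˢ Σ₂) ≤ bdim Σ₁) ×
    (Balanced Σ₁ → bdim (Σ₁ ×ˢ Σ₂) ≤ bdim Σ₂)
theorem2p28 Σ₁ Σ₂ connected₁ connected₂ =
  (λ balanced₂ → bdim-mono (Σ₁ ×ˢ Σ₂) Σ₁
    (switchesToPositive-pullback (Σ₁ ×ˢ Σ₂) Σ₁ proj₁ proj₁
      (potential Σ₂ connected₂ balanced₂ ∘ proj₂)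
      (λ (e , f) → cong (S₁.σ e Sign.*_)
        (potential-isPotential Σ₂ connected₂ balanced₂ f)))) ,
  (λ balanced₁ → bdim-mono (Σ₁ ×ˢ Σ₂) Σ₂
    (switchesToPositive-pullback (Σ₁ ×ˢ Σ₂) Σ₂ proj₂ proj₂
      (potential Σ₁ connected₁ balanced₁ ∘ proj₁)
      -- The product signature puts the sign from `Σ₁` first, while the pullback expects the sign of
      -- the retained factor `Σ₂` first.
      (λ (e , f) → trans (Sign.*-comm (S₁.σ e) (S₂.σ f))
        (cong (S₂.σ f Sign.*_) (potential-isPotential Σ₁ connected₁ balanced₁ e)))))
  where
  module S₁ = SignedGraph Σ₁
  module S₂ = SignedGraph Σ₂
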